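{- Let $m\geq 3$, $n\geq 3$ and $x$ be positive integers such that both $m$ and $n$ divide $3x$, and let $h,u$ be positive integers. Suppose the following conditions are satisfied: (i) there exists a $3$-RGDD$(h^u)$; (ii) there exists an $(m,n)\text{ - }\mathrm{HWP}(3x;r_\beta,s_\beta)$; (iii) there exists a decomposition of $K_{(x:h)}$ into $r_\gamma$ $C_m$-factors and $s_\gamma$ $C_n$-factors; (iv) for each $p\in\{1,2,\ldots,\frac{h(u-1)}{2}\}$, there exists a decomposition of $K_{(x:3)}$ into $r_p$ $C_m$-factors and $s_p$ $C_n$-factors. Let $$r_\alpha=\sum_{p=1}^{\frac{h(u-1)}{2}-1} r_p\quad\text{and}\quad s_\alpha=\sum_{p=1}^{\frac{h(u-1)}{2}-1} s_p.$$ Then there exists an $(m,n)\text{ - }\mathrm{HWP}(hux;r_\alpha+r_\beta+r_\gamma,s_\alpha+s_\beta+s_\gamma)$.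
   Context: A $C_m$-factor of a graph $G$ is a spanning subgraph of $G$ all of whose connected components are cycles of length $m$. A decomposition of a graph is a partition of its edge set into (edge sets of) subgraphs. For integers $m,n\ge 3$, $v\geq 1$ and $r,s\geq 0$, an $(m,n)\text{ - }\mathrm{HWP}(v;r,s)$ is a decomposition of the complete graph $K_v$ if $v$ is odd, or of $K_v-F$ for some $1$-factor (perfect matching) $F$ of $K_v$ if $v$ is even, into $r$ $C_m$-factors and $s$ $C_n$-factors. $K_{(h:u)}$ denotes the complete multipartite graph with $u$ parts of size $h$. A $3$-RGDD$(h^u)$ (resolvable group divisible design with block size $3$ and index $1$) is a triple $(\mathcal{V},\mathcal{G},\mathcal{B})$ where $\mathcal{V}$ is a set of size $hu$, $\mathcal{G}$ is a partition of $\mathcal{V}$ into $u>1$ subsets (called groups) of size $h$, and $\mathcal{B}$ is a collection of $3$-element subsets of $\mathcal{V}$ (called blocks) such that no two distinct elements of the same group lie together in a block, any two elements from different groups lie together in exactly one block, and $\mathcal{B}$ can be partitioned into parallel classes, each element of $\mathcal{V}$ lying in exactly one block of each parallel class. (Such a design has $\frac{h(u-1)}{2}$ parallel classes.) -}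

module Defs where

open import Data.Fin.Base using (Fin; toℕ)
open import Data.Fin.Properties using () renaming (_≟_ to _≟ᶠ_)
open import Data.Fin.Subset using (Subset; _∈_; ∣_∣)
open import Data.Nat.Base using (ℕ; suc; _*_; _<_)
open import Data.Nat.Divisibility using (_∣_)
open import Data.Product.Base using (∃; _×_; _,_; proj₁)
open import Data.Product using (∃!)
open import Data.Sum.Base using (_⊎_; inj₁; inj₂)
open import Function.Bundles using (_⇔_)
open import Function.Base using (_∘_)
open import Function.Definitions using (Injective)
open import Level using (0ℓ)
open import Relation.Binary.Construct.Closure.ReflexiveTransitive using (Star)
open import Relation.Binary.Core using (Rel; _⇒_)
open import Relation.Binary.Definitions using (Symmetric; Irreflexive; Decidable)
open import Relation.Binary.PropositionalEquality.Core using (_≡_; _≢_; refl; sym)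
open import Relation.Nullary.Decidable using (¬?; _×-dec_)
open import Relation.Nullary.Negation using (¬_)
open import Relation.Unary using (Pred)

record Graph (V : Set) : Set₁ where
  field
    Adj    : Rel V 0ℓ
    symm   : Symmetric Adj
    irrefl : Irreflexive _≡_ Adj
    adj?   : Decidable Adj

open Graph public

-- Both graphs have vertex type V, so this is the spanning subgraph relation.
-- Parts of a decomposition lose nothing by it: they are edge sets.
_⊆_ : {V : Set} → Graph V → Graph V → Set
H ⊆ G = Adj H ⇒ Adj G

K : (v : ℕ) → Graph (Fin v)
K v = record
  { Adj    = _≢_
  ; symm   = _∘ sym
  ; irrefl = λ x≡y x≢y → x≢y x≡y
  ; adj?   = λ x y → ¬? (x ≟ᶠ y)
  }

-- K[ h ∶ u ] has u parts of size h; (i , a) is the a-th vertex of part i.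
K[_∶_] : (h u : ℕ) → Graph (Fin u × Fin h)
K[ h ∶ u ] = record
  { Adj    = λ x y → proj₁ x ≢ proj₁ y
  ; symm   = _∘ sym
  ; irrefl = λ { refl x≢x → x≢x refl }
  ; adj?   = λ x y → ¬? (proj₁ x ≟ᶠ proj₁ y)
  }

_─_ : {V : Set} → Graph V → Graph V → Graph V
G ─ F = record
  { Adj    = λ x y → Adj G x y × ¬ Adj F x y
  ; symm   = λ (g , ¬f) → symm G g , ¬f ∘ symm F
  ; irrefl = λ x≡y (g , _) → irrefl G x≡y g
  ; adj?   = λ x y → adj? G x y ×-dec ¬? (adj? F x y)
  }

CyclicSuc : {m : ℕ} → Rel (Fin m) 0ℓ
CyclicSuc {m} i j =
  suc (toℕ i) ≡ toℕ j ⊎ (suc (toℕ i) ≡ m × toℕ j ≡ 0)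

-- The cycle 0, 1, …, m-1, 0. It has length m only for m ≥ 3: there is a loop
-- for m = 1 and a single edge for m = 2.
CycleAdj : {m : ℕ} → Rel (Fin m) 0ℓ
CycleAdj i j = CyclicSuc i j ⊎ CyclicSuc j i

-- The subgraph of G induced on P is a cycle of length m.
record IsCycleOn {V : Set} (m : ℕ) (G : Graph V) (P : Pred V 0ℓ) : Set where
  field
    vertex    : Fin m → V
    injective : Injective _≡_ _≡_ vertex
    image     : ∀ y → P y ⇔ ∃ λ i → vertex i ≡ y
    adjacent  : ∀ i j → Adj G (vertex i) (vertex j) ⇔ CycleAdj i j

-- The vertex set of the connected component containing x.
Component : {V : Set} → Graph V → V → Pred V 0ℓ
Component G x y = Star (Adj G) x y

record IsCycleFactor {V : Set} (m : ℕ) (G H : Graph V) : Set where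
  field
    subgraph   : H ⊆ G
    components : ∀ x → IsCycleOn m H (Component H x)

record IsOneFactor {V : Set} (G F : Graph V) : Set where
  field
    subgraph  : F ⊆ G
    neighbour : ∀ x → ∃! _≡_ (Adj F x)

record IsDecomposition {V I : Set} (G : Graph V) (H : I → Graph V) : Set where
  field
    subgraph  : ∀ i → H i ⊆ G
    partition : ∀ {x y} → Adj G x y → ∃! _≡_ (λ i → Adj (H i) x y)

record CycleFactorization {V : Set} (m n : ℕ) (G : Graph V) (r s : ℕ) : Set₁ where
  field
    factor        : Fin r ⊎ Fin s → Graph V
    decomposition : IsDecomposition G factor
    m-factors     : ∀ i → IsCycleFactor m G (factor (inj₁ i))
    n-factors     : ∀ j → IsCycleFactor n G (factor (inj₂ j))

data HWP (m n v r s : ℕ) : Set₁ where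
  odd  : ¬ (2 ∣ v) → CycleFactorization m n (K v) r s → HWP m n v r s
  even : 2 ∣ v → (F : Graph (Fin v)) → IsOneFactor (K v) F →
         CycleFactorization m n (K v ─ F) r s → HWP m n v r s

-- Blocks form an indexed family. No block is repeated: its points lie in
-- pairwise different groups, and two such points determine the index.
-- #classes is not prescribed: counting the blocks through a point forces
-- 2 * #classes ≡ h * (u ∸ 1).
record 3-RGDD (h u : ℕ) : Set where
  field
    u>1         : 1 < u

    group       : Fin u → Subset (h * u)
    group-size  : ∀ i → ∣ group i ∣ ≡ h
    group-part  : ∀ x → ∃! _≡_ (λ i → x ∈ group i)

    #blocks     : ℕ
    block       : Fin #blocks → Subset (h * u)
    block-size  : ∀ b → ∣ block b ∣ ≡ 3
    same-group  : ∀ {i x y} → x ∈ group i → y ∈ group i → x ≢ y →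
                  ∀ b → ¬ (x ∈ block b × y ∈ block b)
    cross-group : ∀ {i j x y} → x ∈ group i → y ∈ group j → i ≢ j →
                  ∃! _≡_ (λ b → x ∈ block b × y ∈ block b)

    #classes    : ℕ
    class       : Fin #blocks → Fin #classes
    parallel    : ∀ c x → ∃! _≡_ (λ b → class b ≡ c × x ∈ block b)

{-# OPTIONS --safe #-}

-- Give every point of the design weight x. A block of each parallel class but
-- one is inflated to K[ x ∶ 3 ], a block of the remaining class to K (3 * x),
-- which also covers the fibres over its points, and a group to K[ x ∶ h ].
-- Each edge is then covered once, and the 1-factors missing from the copies of
-- K (3 * x) form a 1-factor of the whole. Parity is settled by degrees: the
-- cycles of K[ x ∶ h ] and the triangles through a point give
-- 2 (r + s) + x = h x and 2 k + h = h u for k parallel classes, so that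
-- h u x is even only if x is.
module Submission where

open import Data.Empty using (⊥)
open import Data.Fin.Base using (Fin; zero; suc; toℕ; fromℕ; fromℕ<; inject₁; splitAt;
  join; remQuot; quotient; combine; punchIn; punchOut)
open import Data.Fin.Properties using (toℕ-injective; toℕ<n; toℕ-fromℕ; toℕ-fromℕ<;
  toℕ-inject₁; splitAt-join; join-splitAt; remQuot-combine; combine-remQuot; *↔×; +↔⊎;
  punchIn-injective; punchInᵢ≢i; punchIn-punchOut; suc-injective) renaming (_≟_ to _≟ᶠ_)
open import Data.Fin.Permutation using (↔⇒≡)
open import Data.Fin.Subset using (Subset; inside; outside; _∈_; ∣_∣)
open import Data.List.Base using (applyUpTo; sum)
open import Data.Nat.Base using (ℕ; zero; suc; _+_; _*_; _∸_; _≤_; _/_; z≤n; s≤s; s≤s⁻¹;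
  >-nonZero)
open import Data.Nat.Divisibility using (_∣_; _∣?_; ∣-refl; n∣m*n; ∣m⇒∣m*n; ∣n⇒∣m*n;
  ∣m+n∣m⇒∣n)
open import Data.Nat.DivMod using (m*n/n≡m)
open import Data.Nat.Primality using (euclidsLemma; prime[2])
open import Data.Nat.Properties using (≤-refl; m≤n⇒m≤1+n; <-irrefl; ≤∧≢⇒<; m+n∸n≡m;
  *-distribˡ-∸; *-identityʳ; *-cancelˡ-≡; *-mono-≤; m<n⇒m<1+n) renaming (_≟_ to _≟ⁿ_;
  suc-injective to suc-injectiveⁿ)
open import Data.Product.Base using (∃; _×_; _,_; proj₁; proj₂)
open import Data.Product.Function.NonDependent.Propositional using (_×-↔_)
open import Data.Sum.Base using (_⊎_; inj₁; inj₂; [_,_]′) renaming (map to map⊎)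
open import Data.Sum.Function.Propositional using (_⊎-↔_)
open import Data.Unit.Base using (⊤; tt)
open import Data.Vec.Base using ([]; _∷_; here; there)
open import Function.Base using (_∘_; id)
open import Function.Bundles using (_↔_; mk↔ₛ′; mk⇔; module Inverse; module Equivalence)
open import Function.Definitions using (Injective)
open import Function.Properties.Inverse using (↔-refl; ↔-trans; ↔-sym)
open import Level using (0ℓ)
open import Relation.Binary.Construct.Closure.ReflexiveTransitive using (ε; _◅_; gmap)
open import Relation.Binary.PropositionalEquality
open import Relation.Nullary.Decidable using (yes; no; from-no; ¬?; _×-dec_; _⊎-dec_;
  decidable-stable)
open import Relation.Nullary.Negation using (¬_; contradiction)
open import Relation.Unary using (Pred)
open import Defs

-- Counting

-- A labelling of the elements satisfying `P` by `J`. `index` receives a proof, but its value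
-- depends on the element only, because `elt` is injective; so adjacency proofs may come in several
-- forms.
record Enumeration {A : Set} (P : Pred A 0ℓ) (J : Set) : Set where
  field
    elt           : J → A
    elt-∈         : ∀ j → P (elt j)
    elt-injective : Injective _≡_ _≡_ elt
    index         : ∀ {y} → P y → J
    elt-index     : ∀ {y} (p : P y) → elt (index p) ≡ y

open Enumeration

-- Both inverse laws reduce to equations in `A`, where `elt` is injective. With `↔⇒≡` this turns two
-- enumerations of one set into an equation between numbers.
enumeration-unique : {A J L : Set} {P : Pred A 0ℓ} →
  Enumeration P J → Enumeration P L → J ↔ L
enumeration-unique E E′ = mk↔ₛ′
  (λ j → index E′ (elt-∈ E j))
  (λ l → index E (elt-∈ E′ l))
  (λ l → elt-injective E′ (trans (elt-index E′ _) (elt-index E _)))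
  (λ j → elt-injective E (trans (elt-index E _) (elt-index E′ _)))

enumerate-all : {A : Set} → Enumeration {A} (λ _ → ⊤) A
enumerate-all = record
  { elt = id ; elt-∈ = λ _ → tt ; elt-injective = id
  ; index = λ {y} _ → y ; elt-index = λ _ → refl }

enumerate-subset : ∀ {n} (S : Subset n) → Enumeration (_∈ S) (Fin ∣ S ∣)
enumerate-subset [] = record
  { elt = λ () ; elt-∈ = λ () ; elt-injective = λ { {()} } ; index = λ () ; elt-index = λ () }
enumerate-subset {suc n} (inside ∷ S) = record
  { elt = elt′ ; elt-∈ = elt′-∈ ; elt-injective = injective
  ; index = index′ ; elt-index = elt-index′ }
  where
  E = enumerate-subset S
  elt′ : Fin (suc ∣ S ∣) → Fin (suc n)
  elt′ zero    = zero
  elt′ (suc j) = suc (elt E j)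
  elt′-∈ : ∀ j → elt′ j ∈ (inside ∷ S)
  elt′-∈ zero    = here
  elt′-∈ (suc j) = there (elt-∈ E j)
  injective : Injective _≡_ _≡_ elt′
  injective {zero}  {zero}  _  = refl
  injective {suc _} {suc _} eq = cong suc (elt-injective E (suc-injective eq))
  index′ : ∀ {y} → y ∈ (inside ∷ S) → Fin (suc ∣ S ∣)
  index′ here      = zero
  index′ (there p) = suc (index E p)
  elt-index′ : ∀ {y} (p : y ∈ (inside ∷ S)) → elt′ (index′ p) ≡ y
  elt-index′ here      = refl
  elt-index′ (there p) = cong suc (elt-index E p)
enumerate-subset (outside ∷ S) = record
  { elt           = suc ∘ elt E
  ; elt-∈         = there ∘ elt-∈ E
  ; elt-injective = elt-injective E ∘ suc-injective
  ; index         = λ { (there p) → index E p }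
  ; elt-index     = λ { (there p) → cong suc (elt-index E p) }
  }
  where E = enumerate-subset S

-- Each neighbour of `v` is reached through exactly one part of the decomposition, so if every part
-- has degree `J` at `v`, the pairs of a part and a label count the neighbours.
degree-sum : {V I J : Set} {G : Graph V} {H : I → Graph V} {v : V} →
  IsDecomposition G H → (∀ i → Enumeration (Adj (H i) v) J) →
  Enumeration (Adj G v) (I × J)
degree-sum {I = I} {J} {G} {H} {v} dec E = record
  { elt           = λ (i , j) → elt (E i) j
  ; elt-∈         = λ (i , j) → subgraph i (elt-∈ (E i) j)
  ; elt-injective = injective
  ; index         = λ g → let (i , a , _) = partition g in i , index (E i) a
  ; elt-index     = λ g → let (i , a , _) = partition g in elt-index (E i) a
  }
  where
  open IsDecomposition dec
  injective : Injective _≡_ _≡_ (λ ((i , j) : I × J) → elt (E i) j)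
  injective {i , j} {i′ , j′} eq
    -- Equal endpoints mean the same edge at `v`, and that edge lies in only one part, so `i` and
    -- `i′` coincide.
    with partition (subgraph i (elt-∈ (E i) j))
  ... | _ , _ , unique
    with trans (sym (unique (elt-∈ (E i) j)))
               (unique (subst (Adj (H i′) v) (sym eq) (elt-∈ (E i′) j′)))
  ... | refl = cong (i ,_) (elt-injective (E i) eq)

-- Decidable adjacency splits the vertices into neighbours and non-neighbours of `v`, with `v`
-- itself among the latter. Both degree equations come from this bijection.
degree-complement : {V J L : Set} (G : Graph V) {v : V} →
  Enumeration (Adj G v) J → Enumeration (λ y → ¬ Adj G v y) L →
  (J ⊎ L) ↔ V
degree-complement {V} {J} {L} G {v} E E′ = enumeration-unique all enumerate-all
  where
  elt⊎ : J ⊎ L → V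
  elt⊎ = [ elt E , elt E′ ]′
  injective : Injective _≡_ _≡_ elt⊎
  injective {inj₁ _} {inj₁ _} eq = cong inj₁ (elt-injective E eq)
  injective {inj₁ j} {inj₂ l} eq =
    contradiction (subst (Adj G v) eq (elt-∈ E j)) (elt-∈ E′ l)
  injective {inj₂ l} {inj₁ j} eq =
    contradiction (subst (Adj G v) (sym eq) (elt-∈ E j)) (elt-∈ E′ l)
  injective {inj₂ _} {inj₂ _} eq = cong inj₂ (elt-injective E′ eq)
  index⊎ : V → J ⊎ L
  index⊎ y with adj? G v y
  ... | yes a = inj₁ (index E a)
  ... | no ¬a = inj₂ (index E′ ¬a)
  elt-index⊎ : ∀ y → elt⊎ (index⊎ y) ≡ y
  elt-index⊎ y with adj? G v y
  ... | yes a = elt-index E a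
  ... | no ¬a = elt-index E′ ¬a
  all : Enumeration (λ _ → ⊤) (J ⊎ L)
  all = record
    { elt = elt⊎ ; elt-∈ = λ _ → tt ; elt-injective = injective
    ; index = λ {y} _ → index⊎ y ; elt-index = λ {y} _ → elt-index⊎ y }

-- Degrees of cycle factors

next : ∀ {m} (i : Fin m) → ∃ (CyclicSuc i)
next {suc m} i with toℕ i ≟ⁿ m
... | yes i≡m = zero , inj₂ (cong suc i≡m , refl)
... | no  i≢m = fromℕ< i<m , inj₁ (sym (toℕ-fromℕ< i<m))
  where i<m = s≤s (≤∧≢⇒< (s≤s⁻¹ (toℕ<n i)) i≢m)

previous : ∀ {m} (i : Fin m) → ∃ λ j → CyclicSuc j i
previous {suc m} zero    = fromℕ m , inj₂ (cong suc (toℕ-fromℕ m) , refl)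
previous {suc m} (suc i) = inject₁ i , inj₁ (cong suc (toℕ-inject₁ i))

next-unique : ∀ {m} {i j k : Fin m} → CyclicSuc i j → CyclicSuc i k → j ≡ k
next-unique (inj₁ p) (inj₁ q) = toℕ-injective (trans (sym p) q)
next-unique {j = j} (inj₁ p) (inj₂ (q , _)) =
  contradiction (toℕ<n j) (<-irrefl (trans (sym p) q))
next-unique {k = k} (inj₂ (p , _)) (inj₁ q) =
  contradiction (toℕ<n k) (<-irrefl (trans (sym q) p))
next-unique (inj₂ (_ , p)) (inj₂ (_ , q)) = toℕ-injective (trans p (sym q))

previous-unique : ∀ {m} {i j k : Fin m} → CyclicSuc j i → CyclicSuc k i → j ≡ k
previous-unique (inj₁ p) (inj₁ q) = toℕ-injective (suc-injectiveⁿ (trans p (sym q)))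
previous-unique (inj₁ p) (inj₂ (_ , q)) = contradiction (trans p q) λ ()
previous-unique (inj₂ (_ , p)) (inj₁ q) = contradiction (trans q p) λ ()
previous-unique (inj₂ (p , _)) (inj₂ (q , _)) =
  toℕ-injective (suc-injectiveⁿ (trans p (sym q)))

-- Two vertices that succeed each other would close up a cycle of length at most two.
cyclicSuc-asymmetric : ∀ {m} {i j : Fin m} → 3 ≤ m → CyclicSuc i j → ¬ CyclicSuc j i
cyclicSuc-asymmetric {i = i} {j} 3≤m = asym (toℕ i) (toℕ j) 3≤m
  where
  -- Generalised to natural numbers `a` and `b`, since equations about variables can be matched with
  -- `refl`, while those about `toℕ i` cannot.
  asym : ∀ {m} a b → 3 ≤ m → suc a ≡ b ⊎ (suc a ≡ m × b ≡ 0) →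
         ¬ (suc b ≡ a ⊎ (suc b ≡ m × a ≡ 0))
  asym a b _ (inj₁ refl) (inj₁ q) =
    <-irrefl (sym q) (m<n⇒m<1+n ≤-refl)
  asym a b (s≤s (s≤s ())) (inj₁ refl) (inj₂ (refl , refl))
  asym a b (s≤s (s≤s ())) (inj₂ (refl , refl)) (inj₁ refl)

-- The two neighbours are the successor and the predecessor; `3 ≤ m` keeps them apart.
cycle-degree : ∀ {m} → 3 ≤ m → (i : Fin m) → Enumeration (CycleAdj i) (Fin 2)
cycle-degree {m} 3≤m i = record
  { elt = elt′ ; elt-∈ = elt′-∈ ; elt-injective = injective
  ; index = index′ ; elt-index = elt-index′ }
  where
  elt′ : Fin 2 → Fin m
  elt′ zero       = proj₁ (next i)
  elt′ (suc zero) = proj₁ (previous i)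
  elt′-∈ : ∀ j → CycleAdj i (elt′ j)
  elt′-∈ zero       = inj₁ (proj₂ (next i))
  elt′-∈ (suc zero) = inj₂ (proj₂ (previous i))
  distinct : elt′ zero ≢ elt′ (suc zero)
  distinct eq = cyclicSuc-asymmetric 3≤m
    (subst (CyclicSuc i) eq (proj₂ (next i))) (proj₂ (previous i))
  injective : Injective _≡_ _≡_ elt′
  injective {zero}     {zero}     _  = refl
  injective {zero}     {suc zero} eq = contradiction eq distinct
  injective {suc zero} {zero}     eq = contradiction (sym eq) distinct
  injective {suc zero} {suc zero} _  = refl
  index′ : ∀ {y} → CycleAdj i y → Fin 2
  index′ (inj₁ _) = zero
  index′ (inj₂ _) = suc zero
  elt-index′ : ∀ {y} (a : CycleAdj i y) → elt′ (index′ a) ≡ y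
  elt-index′ (inj₁ s) = next-unique (proj₂ (next i)) s
  elt-index′ (inj₂ s) = previous-unique (proj₂ (previous i)) s

-- A neighbour of `v` lies in the component of `v` by a path of one step, so the numbering of that
-- cycle, in which `v` has number `i`, carries over the two cyclic neighbours of `i`.
cycleFactor-degree : ∀ {m} {V : Set} {G H : Graph V} → 3 ≤ m → IsCycleFactor m G H →
  ∀ v → Enumeration (Adj H v) (Fin 2)
cycleFactor-degree {H = H} 3≤m factor v = record
  { elt           = vertex ∘ elt E
  ; elt-∈         = λ j → subst (λ w → Adj H w (vertex (elt E j))) vertex-i≡v
                            (Equivalence.from (adjacent i _) (elt-∈ E j))
  ; elt-injective = elt-injective E ∘ injective
  ; index         = λ a → index E (proj₁ (proj₂ (locate a)))
  ; elt-index     = λ a → let (j , c , eq) = locate a in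
                            trans (cong vertex (elt-index E c)) eq
  }
  where
  open IsCycleOn (IsCycleFactor.components factor v)
  i = proj₁ (Equivalence.to (image v) ε)
  vertex-i≡v = proj₂ (Equivalence.to (image v) ε)
  E = cycle-degree 3≤m i
  locate : ∀ {y} → Adj H v y → ∃ λ j → CycleAdj i j × vertex j ≡ y
  locate {y} a with Equivalence.to (image y) (a ◅ ε)
  ... | j , refl =
    j , Equivalence.to (adjacent i j) (subst (λ w → Adj H w (vertex j)) (sym vertex-i≡v) a) , refl

factorization-degree : ∀ {m n r s} {V : Set} {G : Graph V} → 3 ≤ m → 3 ≤ n →
  CycleFactorization m n G r s →
  ∀ v → Enumeration (Adj G v) ((Fin r ⊎ Fin s) × Fin 2)
factorization-degree 3≤m 3≤n F v = degree-sum decomposition λ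
  { (inj₁ i) → cycleFactor-degree 3≤m (m-factors i) v
  ; (inj₂ j) → cycleFactor-degree 3≤n (n-factors j) v }
  where open CycleFactorization F

-- Seen from one vertex, the `h * x` vertices are its neighbours, two for each cycle factor, and the
-- `x` vertices of its own part. Positivity of `x` and `h` supplies the vertex `(zero , zero)`.
multipartite-degree : ∀ {m n x h r s} → 3 ≤ m → 3 ≤ n → 1 ≤ x → 1 ≤ h →
  CycleFactorization m n K[ x ∶ h ] r s → (r + s) * 2 + x ≡ h * x
multipartite-degree {x = x@(suc _)} {h@(suc _)} {r} {s} 3≤m 3≤n _ _ F = ↔⇒≡
  (↔-trans labels
  (↔-trans (degree-complement K[ x ∶ h ] {zero , zero}
             (factorization-degree 3≤m 3≤n F (zero , zero)) part)
           (↔-sym *↔×)))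
  where
  labels : Fin ((r + s) * 2 + x) ↔ ((Fin r ⊎ Fin s) × Fin 2 ⊎ Fin x)
  labels = ↔-trans +↔⊎ (↔-trans (*↔× {r + s} {2}) (+↔⊎ {r} {s} ×-↔ ↔-refl) ⊎-↔ ↔-refl)
  part : Enumeration (λ y → ¬ Adj K[ x ∶ h ] (zero , zero) y) (Fin x)
  part = record
    { elt           = zero ,_
    ; elt-∈         = λ _ 0≢0 → 0≢0 refl
    ; elt-injective = cong proj₂
    ; index         = λ {y} _ → proj₂ y
    ; elt-index     = λ {y} ¬¬eq →
        cong (_, proj₂ y) (decidable-stable (zero ≟ᶠ proj₁ y) ¬¬eq)
    }

-- Unions of factorizations

∅ : {V : Set} → Graph V
∅ = record { Adj = λ _ _ → ⊥ ; symm = id ; irrefl = λ _ () ; adj? = λ _ _ → no id }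

_∪_ : {V : Set} → Graph V → Graph V → Graph V
G ∪ H = record
  { Adj    = λ x y → Adj G x y ⊎ Adj H x y
  ; symm   = map⊎ (symm G) (symm H)
  ; irrefl = λ x≡y → [ irrefl G x≡y , irrefl H x≡y ]′
  ; adj?   = λ x y → adj? G x y ⊎-dec adj? H x y
  }

⋃ : {V : Set} (k : ℕ) → (Fin k → Graph V) → Graph V
⋃ zero    H = ∅
⋃ (suc k) H = H zero ∪ ⋃ k (H ∘ suc)

⋃⁺ : {V : Set} {k : ℕ} (H : Fin k → Graph V) (i : Fin k) → H i ⊆ ⋃ k H
⋃⁺ H zero    a = inj₁ a
⋃⁺ H (suc i) a = inj₂ (⋃⁺ (H ∘ suc) i a)

⋃⁻ : {V : Set} {k : ℕ} (H : Fin k → Graph V) {x y : V} →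
     Adj (⋃ k H) x y → ∃ λ i → Adj (H i) x y
⋃⁻ {k = suc k} H (inj₁ a) = zero , a
⋃⁻ {k = suc k} H (inj₂ a) = let (i , b) = ⋃⁻ (H ∘ suc) a in suc i , b

Disjoint : {V : Set} → Graph V → Graph V → Set
Disjoint G H = ∀ {x y} → Adj G x y → ¬ Adj H x y

cycleFactor-⊆ : ∀ {m} {V : Set} {G G′ H : Graph V} →
  G ⊆ G′ → IsCycleFactor m G H → IsCycleFactor m G′ H
cycleFactor-⊆ G⊆G′ F = record
  { subgraph   = λ a → G⊆G′ (IsCycleFactor.subgraph F a)
  ; components = IsCycleFactor.components F }

-- Graphs with equivalent adjacency need not be equal as records, so factorizations are transported
-- along mutual inclusion.
factorization-resp : ∀ {m n r s} {V : Set} {G G′ : Graph V} → G ⊆ G′ → G′ ⊆ G →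
  CycleFactorization m n G r s → CycleFactorization m n G′ r s
factorization-resp {G = G} {G′} G⊆G′ G′⊆G F = record
  { factor        = factor
  ; decomposition = record
    { subgraph  = λ i a → G⊆G′ (IsDecomposition.subgraph decomposition i a)
    ; partition = λ a → IsDecomposition.partition decomposition (G′⊆G a) }
  ; m-factors = λ i → cycleFactor-⊆ {G = G} {G′} G⊆G′ (m-factors i)
  ; n-factors = λ j → cycleFactor-⊆ {G = G} {G′} G⊆G′ (n-factors j)
  }
  where open CycleFactorization F

factorization-∅ : ∀ {m n} {V : Set} → CycleFactorization m n (∅ {V}) 0 0
factorization-∅ = record
  { factor        = λ _ → ∅
  ; decomposition = record { subgraph = λ _ () ; partition = λ () }
  ; m-factors     = λ ()
  ; n-factors     = λ ()
  }

-- Disjointness means that a factor of one graph never contains an edge of the other, so each edge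
-- still has a unique factor. The rest regroups indices: the sum over the two graphs becomes a sum
-- over the two cycle lengths.
factorization-∪ : ∀ {m n r₁ s₁ r₂ s₂} {V : Set} {G₁ G₂ : Graph V} →
  Disjoint G₁ G₂ → CycleFactorization m n G₁ r₁ s₁ → CycleFactorization m n G₂ r₂ s₂ →
  CycleFactorization m n (G₁ ∪ G₂) (r₁ + r₂) (s₁ + s₂)
factorization-∪ {m} {n} {r₁} {s₁} {r₂} {s₂} {V} {G₁} {G₂} disjoint F₁ F₂ = record
  { factor        = factor ∘ split
  ; decomposition = record { subgraph = λ i → ⊆-∪ (split i) ; partition = partition }
  ; m-factors     = m-factors
  ; n-factors     = n-factors
  }
  where
  module F₁ = CycleFactorization F₁
  module F₂ = CycleFactorization F₂
  module D₁ = IsDecomposition F₁.decomposition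
  module D₂ = IsDecomposition F₂.decomposition

  I₁ = Fin r₁ ⊎ Fin s₁
  I₂ = Fin r₂ ⊎ Fin s₂

  split : Fin (r₁ + r₂) ⊎ Fin (s₁ + s₂) → I₁ ⊎ I₂
  split (inj₁ i) = map⊎ inj₁ inj₁ (splitAt r₁ i)
  split (inj₂ j) = map⊎ inj₂ inj₂ (splitAt s₁ j)

  unsplit : I₁ ⊎ I₂ → Fin (r₁ + r₂) ⊎ Fin (s₁ + s₂)
  unsplit (inj₁ (inj₁ i)) = inj₁ (join r₁ r₂ (inj₁ i))
  unsplit (inj₁ (inj₂ j)) = inj₂ (join s₁ s₂ (inj₁ j))
  unsplit (inj₂ (inj₁ i)) = inj₁ (join r₁ r₂ (inj₂ i))
  unsplit (inj₂ (inj₂ j)) = inj₂ (join s₁ s₂ (inj₂ j))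

  split-unsplit : ∀ i → split (unsplit i) ≡ i
  split-unsplit (inj₁ (inj₁ i)) = cong (map⊎ inj₁ inj₁) (splitAt-join r₁ r₂ (inj₁ i))
  split-unsplit (inj₁ (inj₂ j)) = cong (map⊎ inj₂ inj₂) (splitAt-join s₁ s₂ (inj₁ j))
  split-unsplit (inj₂ (inj₁ i)) = cong (map⊎ inj₁ inj₁) (splitAt-join r₁ r₂ (inj₂ i))
  split-unsplit (inj₂ (inj₂ j)) = cong (map⊎ inj₂ inj₂) (splitAt-join s₁ s₂ (inj₂ j))

  unsplit-split : ∀ i → unsplit (split i) ≡ i
  unsplit-split (inj₁ i) with splitAt r₁ i in eq
  ... | inj₁ _ = cong inj₁ (trans (cong (join r₁ r₂) (sym eq)) (join-splitAt r₁ r₂ i))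
  ... | inj₂ _ = cong inj₁ (trans (cong (join r₁ r₂) (sym eq)) (join-splitAt r₁ r₂ i))
  unsplit-split (inj₂ j) with splitAt s₁ j in eq
  ... | inj₁ _ = cong inj₂ (trans (cong (join s₁ s₂) (sym eq)) (join-splitAt s₁ s₂ j))
  ... | inj₂ _ = cong inj₂ (trans (cong (join s₁ s₂) (sym eq)) (join-splitAt s₁ s₂ j))

  factor : I₁ ⊎ I₂ → Graph V
  factor = [ F₁.factor , F₂.factor ]′

  ⊆-∪ : ∀ i → factor i ⊆ (G₁ ∪ G₂)
  ⊆-∪ (inj₁ i) a = inj₁ (D₁.subgraph i a)
  ⊆-∪ (inj₂ i) a = inj₂ (D₂.subgraph i a)

  unique : ∀ {x y} → Adj (G₁ ∪ G₂) x y →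
    ∃ λ i → Adj (factor i) x y × (∀ j → Adj (factor j) x y → i ≡ j)
  unique (inj₁ g) with D₁.partition g
  ... | i , a , i-unique = inj₁ i , a , λ
    { (inj₁ j) b → cong inj₁ (i-unique b)
    ; (inj₂ j) b → contradiction (D₂.subgraph j b) (disjoint g) }
  unique (inj₂ g) with D₂.partition g
  ... | i , a , i-unique = inj₂ i , a , λ
    { (inj₁ j) b → contradiction g (disjoint (D₁.subgraph j b))
    ; (inj₂ j) b → cong inj₂ (i-unique b) }

  partition : ∀ {x y} → Adj (G₁ ∪ G₂) x y → _
  partition {x} {y} g with unique g
  ... | i , a , i-unique =
    unsplit i
    , subst (λ k → Adj (factor k) x y) (sym (split-unsplit i)) a
    , λ {j} b → trans (cong unsplit (i-unique (split j) b)) (unsplit-split j)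

  m-factors : ∀ i → IsCycleFactor m (G₁ ∪ G₂) (factor (split (inj₁ i)))
  m-factors i with splitAt r₁ i
  ... | inj₁ i₁ = cycleFactor-⊆ {G = G₁} {G₁ ∪ G₂} inj₁ (F₁.m-factors i₁)
  ... | inj₂ i₂ = cycleFactor-⊆ {G = G₂} {G₁ ∪ G₂} inj₂ (F₂.m-factors i₂)

  n-factors : ∀ j → IsCycleFactor n (G₁ ∪ G₂) (factor (split (inj₂ j)))
  n-factors j with splitAt s₁ j
  ... | inj₁ j₁ = cycleFactor-⊆ {G = G₁} {G₁ ∪ G₂} inj₁ (F₁.n-factors j₁)
  ... | inj₂ j₂ = cycleFactor-⊆ {G = G₂} {G₁ ∪ G₂} inj₂ (F₂.n-factors j₂)

-- The counts are functions on all of `ℕ`, so that the induction can shift them to `r ∘ suc` and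
-- `s ∘ suc`, just as `applyUpTo` does.
factorization-⋃ : ∀ {m n} {V : Set} {k : ℕ} (r s : ℕ → ℕ) (H : Fin k → Graph V) →
  (∀ {i j} → i ≢ j → Disjoint (H i) (H j)) →
  (∀ i → CycleFactorization m n (H i) (r (toℕ i)) (s (toℕ i))) →
  CycleFactorization m n (⋃ k H) (sum (applyUpTo r k)) (sum (applyUpTo s k))
factorization-⋃ {k = zero}  r s H disjoint F = factorization-∅
factorization-⋃ {k = suc k} r s H disjoint F = factorization-∪
  (λ a b → let (_ , c) = ⋃⁻ (H ∘ suc) b in disjoint (λ ()) a c)
  (F zero)
  (factorization-⋃ (r ∘ suc) (s ∘ suc) (H ∘ suc)
    (λ i≢j → disjoint (i≢j ∘ suc-injective)) (F ∘ suc))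

-- Tilings

-- A partition of `V` into copies of `W`, with `b` tile numbers available. `place v w` is position
-- `w` in the tile of `v`; it takes a point instead of a tile number because some numbers may name
-- no tile: a parallel class uses only some of all the blocks.
record Tiling (V : Set) (b : ℕ) (W : Set) : Set where
  field
    tile        : V → Fin b
    coord       : V → W
    place       : V → W → V
    tile-place  : ∀ v w → tile (place v w) ≡ tile v
    coord-place : ∀ v w → coord (place v w) ≡ w
    unique      : ∀ {v y} → tile v ≡ tile y → coord v ≡ coord y → v ≡ y

  place-coord : ∀ {v y} → tile v ≡ tile y → place v (coord y) ≡ y
  place-coord eq = unique (trans (tile-place _ _) eq) (coord-place _ _)

open Tiling

across : {V : Set} {b : ℕ} {W : Set} → Tiling V b W → Graph V
across T = record
  { Adj    = λ x y → tile T x ≢ tile T y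
  ; symm   = _∘ sym
  ; irrefl = λ { refl x≢x → x≢x refl }
  ; adj?   = λ x y → ¬? (tile T x ≟ᶠ tile T y)
  }

copies : {V : Set} {b : ℕ} {W : Set} → Tiling V b W → Graph W → Graph V
copies T H = record
  { Adj    = λ x y → tile T x ≡ tile T y × Adj H (coord T x) (coord T y)
  ; symm   = λ (p , a) → sym p , symm H a
  ; irrefl = λ { refl (_ , a) → irrefl H refl a }
  ; adj?   = λ x y → (tile T x ≟ᶠ tile T y) ×-dec adj? H (coord T x) (coord T y)
  }

module _ {V : Set} {b : ℕ} {W : Set} (T : Tiling V b W) where

  place-adj : ∀ {H v w w′} → Adj H w w′ → Adj (copies T H) (place T v w) (place T v w′)
  place-adj {H} a = trans (tile-place T _ _) (sym (tile-place T _ _)) ,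
    subst₂ (Adj H) (sym (coord-place T _ _)) (sym (coord-place T _ _)) a

  component⁻ : ∀ {H x y} → Component (copies T H) x y →
    tile T x ≡ tile T y × Component H (coord T x) (coord T y)
  component⁻ ε = refl , ε
  component⁻ {H} ((p , a) ◅ as) = let (q , c) = component⁻ {H} as in trans p q , a ◅ c

  component⁺ : ∀ {H x y} → tile T x ≡ tile T y → Component H (coord T x) (coord T y) →
    Component (copies T H) x y
  component⁺ {H} {x} eq c = subst₂ (Component (copies T H))
    (place-coord T refl) (place-coord T eq) (gmap (place T x) (place-adj {H}) c)

  -- A path in the copies stays in one tile and projects to a path in `H`; conversely `place` lifts
  -- paths. Hence the component of `x` is a copy of the component of its coordinate, inside the tile
  -- of `x`.
  copies-cycleFactor : ∀ {m G H} →
    IsCycleFactor m G H → IsCycleFactor m (copies T G) (copies T H)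
  copies-cycleFactor {H = H} F = record
    { subgraph   = λ (p , a) → p , subgraph a
    ; components = λ x → let open IsCycleOn (components (coord T x)) in record
      { vertex    = place T x ∘ vertex
      ; injective = λ eq → injective
          (trans (sym (coord-place T _ _)) (trans (cong (coord T) eq) (coord-place T _ _)))
      ; image     = λ y → mk⇔
          (λ c → let (p , c′) = component⁻ {H} c
                     (i , eq) = Equivalence.to (image (coord T y)) c′
                 in i , trans (cong (place T x) eq) (place-coord T p))
          (λ { (i , refl) → component⁺ {H} (sym (tile-place T _ _))
                 (subst (Component H (coord T x)) (sym (coord-place T _ _))
                   (Equivalence.from (image _) (i , refl))) })
      ; adjacent  = λ i j → mk⇔
          (λ (_ , a) → Equivalence.to (adjacent i j)
             (subst₂ (Adj H) (coord-place T _ _) (coord-place T _ _) a))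
          (λ c → place-adj {H} (Equivalence.from (adjacent i j) c))
      }
    }
    where open IsCycleFactor F

  copies-factorization : ∀ {m n G r s} →
    CycleFactorization m n G r s → CycleFactorization m n (copies T G) r s
  copies-factorization F = record
    { factor        = copies T ∘ factor
    ; decomposition = record
      { subgraph  = λ i (p , a) → p , subgraph i a
      ; partition = λ (p , g) → let (i , a , i-unique) = partition g in
          i , (p , a) , λ (_ , b) → i-unique b
      }
    ; m-factors = λ i → copies-cycleFactor (m-factors i)
    ; n-factors = λ j → copies-cycleFactor (n-factors j)
    }
    where
    open CycleFactorization F
    open IsDecomposition decomposition

  tile-enumeration : ∀ v → Enumeration (λ y → ¬ Adj (across T) v y) W
  tile-enumeration v = record
    { elt           = place T v
    ; elt-∈         = λ w v≢ → v≢ (sym (tile-place T v w))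
    ; elt-injective = λ eq →
        trans (sym (coord-place T v _)) (trans (cong (coord T) eq) (coord-place T v _))
    ; index         = λ {y} _ → coord T y
    ; elt-index     = λ {y} ¬¬eq →
        place-coord T (decidable-stable (tile T v ≟ᶠ tile T y) ¬¬eq)
    }

  copies-oneFactor : ∀ {G F} → IsOneFactor G F → IsOneFactor (copies T G) (copies T F)
  copies-oneFactor {F = F} one = record
    { subgraph  = λ (p , a) → p , subgraph a
    ; neighbour = λ x → let (w , a , w-unique) = neighbour (coord T x) in
        place T x w
        , (sym (tile-place T x w) , subst (Adj F (coord T x)) (sym (coord-place T x w)) a)
        , λ (p , b) → trans (cong (place T x) (w-unique b)) (place-coord T p)
    }
    where open IsOneFactor one

-- The neighbours of `v` are the other positions of its tile; `punchIn` skips the position of `v`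
-- itself.
copies-degree : ∀ {V b k} (T : Tiling V b (Fin (suc k))) v →
  Enumeration (Adj (copies T (K (suc k))) v) (Fin k)
copies-degree T v = record
  { elt           = λ j → place T v (punchIn (coord T v) j)
  ; elt-∈         = λ j → sym (tile-place T v _) , λ eq →
      punchInᵢ≢i (coord T v) j (trans (sym (coord-place T v _)) (sym eq))
  ; elt-injective = λ eq → punchIn-injective (coord T v) _ _
      (trans (sym (coord-place T v _)) (trans (cong (coord T) eq) (coord-place T v _)))
  ; index         = λ (_ , c≢) → punchOut c≢
  ; elt-index     = λ (p , c≢) →
      trans (cong (place T v) (punchIn-punchOut c≢)) (place-coord T p)
  }

relabel : ∀ {V b W W′} → W ↔ W′ → Tiling V b W → Tiling V b W′
relabel W↔W′ T = record
  { tile        = tile T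
  ; coord       = to ∘ coord T
  ; place       = λ v → place T v ∘ from
  ; tile-place  = λ v _ → tile-place T v _
  ; coord-place = λ v w → trans (cong to (coord-place T v _)) (strictlyInverseˡ w)
  ; unique      = λ p q → unique T p
      (trans (sym (strictlyInverseʳ _)) (trans (cong from q) (strictlyInverseʳ _)))
  }
  where open Inverse W↔W′

-- Gives each point weight `x`: a vertex is read as a point together with a place in its fibre.
-- Positions in a tile become `W × Fin x`, which for `W = Fin h` is the vertex type of `K[ x ∶ h ]`.
inflate : ∀ {n b W} x → Tiling (Fin n) b W → Tiling (Fin (n * x)) b (W × Fin x)
inflate {n} x T = record
  { tile        = tile T ∘ point
  ; coord       = λ v → coord T (point v) , proj₂ (remQuot {n} x v)
  ; place       = λ v (w , a) → combine (place T (point v) w) a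
  ; tile-place  = λ v (w , a) →
      trans (cong (tile T ∘ proj₁) (remQuot-combine (place T (point v) w) a))
            (tile-place T (point v) w)
  ; coord-place = λ v (w , a) →
      trans (cong (λ (p , c) → coord T p , c) (remQuot-combine (place T (point v) w) a))
            (cong (_, a) (coord-place T (point v) w))
  ; unique      = λ {v} {y} p q → trans (sym (combine-remQuot {n} x v))
      (trans (cong₂ combine (unique T p (cong proj₁ q)) (cong proj₂ q))
             (combine-remQuot {n} x y))
  }
  where
  point : Fin (n * x) → Fin n
  point = quotient x

-- Here `t y` selects the subset that contains `y`. This serves both the groups and the blocks of
-- one parallel class, where the other blocks of the family are never selected.
subsets-tiling : ∀ {n b k} (S : Fin b → Subset n) → (∀ i → ∣ S i ∣ ≡ k) →
  (t : Fin n → Fin b) → (∀ y → y ∈ S (t y)) → (∀ {v y} → y ∈ S (t v) → t y ≡ t v) →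
  Tiling (Fin n) b (Fin k)
subsets-tiling {n} {b} {k} S size t t-∈ t-unique = record
  { tile        = t
  ; coord       = λ v → index (E (t v)) (t-∈ v)
  ; place       = λ v → elt (E (t v))
  ; tile-place  = tile-elt
  ; coord-place = λ v w → same-index (tile-elt v w) (elt-index (E _) _)
  ; unique      = λ {v} {y} p q → trans (sym (elt-index (E (t v)) (t-∈ v)))
      (trans (cong₂ (λ i → elt (E i)) p q) (elt-index (E (t y)) (t-∈ y)))
  }
  where
  E : ∀ i → Enumeration (_∈ S i) (Fin k)
  E i = subst (λ d → Enumeration (_∈ S i) (Fin d)) (size i) (enumerate-subset (S i))

  tile-elt : ∀ v w → t (elt (E (t v)) w) ≡ t v
  tile-elt v w = t-unique (elt-∈ (E (t v)) w)

  -- The tile of a placed point equals `t v` only propositionally, so the two subsets are identified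
  -- before their positions are compared.
  same-index : ∀ {i j w w′} → i ≡ j → elt (E i) w ≡ elt (E j) w′ → w ≡ w′
  same-index {i} refl = elt-injective (E i)

-- Resolvable designs

-- The design in terms of tilings. Its axioms on pairs of points become one statement: the triangles
-- of the parallel classes, grouped by class, decompose the complete multipartite graph on the
-- groups.
record Resolution (n u h b k : ℕ) : Set where
  field
    groups        : Tiling (Fin n) u (Fin h)
    class         : Fin k → Tiling (Fin n) b (Fin 3)
    decomposition : IsDecomposition (across groups) (λ c → copies (class c) (K 3))

resolution : ∀ {h u} → 3-RGDD h u → ∃ λ b → ∃ λ k → Resolution (h * u) u h b k
resolution {h} {u} D = D.#blocks , D.#classes , record
  { groups        = groups
  ; class         = class
  ; decomposition = record { subgraph = subgraph ; partition = partition }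
  }
  where
  module D = 3-RGDD D

  groups : Tiling (Fin (h * u)) u (Fin h)
  groups = subsets-tiling D.group D.group-size
    (λ y → proj₁ (D.group-part y))
    (λ y → proj₁ (proj₂ (D.group-part y)))
    (λ {v} {y} y∈ → proj₂ (proj₂ (D.group-part y)) y∈)

  block-of : Fin D.#classes → Fin (h * u) → Fin D.#blocks
  block-of c y = proj₁ (D.parallel c y)

  class-block-of : ∀ c y → D.class (block-of c y) ≡ c
  class-block-of c y = proj₁ (proj₁ (proj₂ (D.parallel c y)))

  ∈-block-of : ∀ c y → y ∈ D.block (block-of c y)
  ∈-block-of c y = proj₂ (proj₁ (proj₂ (D.parallel c y)))

  block-of-unique : ∀ c {y b} → D.class b ≡ c → y ∈ D.block b → block-of c y ≡ b
  block-of-unique c {y} p y∈ = proj₂ (proj₂ (D.parallel c y)) (p , y∈)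

  class : Fin D.#classes → Tiling (Fin (h * u)) D.#blocks (Fin 3)
  class c = subsets-tiling D.block D.block-size (block-of c) (∈-block-of c)
    (λ {v} y∈ → block-of-unique c (class-block-of c v) y∈)

  group-of-∈ : ∀ y → y ∈ D.group (tile groups y)
  group-of-∈ y = proj₁ (proj₂ (D.group-part y))

  distinct : ∀ c {x y} → Adj (copies (class c) (K 3)) x y → x ≢ y
  distinct c a x≡y = irrefl (copies (class c) (K 3)) x≡y a

  common-block : ∀ c {x y} → Adj (copies (class c) (K 3)) x y →
    x ∈ D.block (block-of c x) × y ∈ D.block (block-of c x)
  common-block c {x} {y} (p , _) =
    ∈-block-of c x , subst (λ b → y ∈ D.block b) (sym p) (∈-block-of c y)

  subgraph : ∀ c → copies (class c) (K 3) ⊆ across groups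
  subgraph c {x} {y} a g =
    D.same-group (group-of-∈ x) (subst (λ i → y ∈ D.group i) (sym g) (group-of-∈ y))
      (distinct c a) (block-of c x) (common-block c a)

  -- The class of an edge is that of the unique block through its ends. Any class joining them does
  -- so by a block through both, hence by this block.
  partition : ∀ {x y} → Adj (across groups) x y → _
  partition {x} {y} g with D.cross-group (group-of-∈ x) (group-of-∈ y) g
  ... | b , (x∈ , y∈) , b-unique =
    D.class b
    , (same-tile , λ same-coord → g (cong (tile groups)
        (unique (class (D.class b)) same-tile same-coord)))
    , λ {c} a → trans (cong D.class (b-unique (common-block c a))) (class-block-of c x)
    where
    same-tile : block-of (D.class b) x ≡ block-of (D.class b) y
    same-tile = trans (block-of-unique _ refl x∈) (sym (block-of-unique _ refl y∈))

-- Counts all points from one of them: two further points in its block of each class, and the `h`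
-- points of its own group.
resolution-count : ∀ {n u h b k} → Resolution n u h b k → 1 ≤ n → k * 2 + h ≡ n
resolution-count {n = suc _} R _ = ↔⇒≡
  (↔-trans +↔⊎ (↔-trans (*↔× ⊎-↔ ↔-refl)
  (degree-complement (across groups)
    (degree-sum decomposition (λ c → copies-degree (class c) zero))
    (tile-enumeration groups zero))))
  where open Resolution R

-- Inflation of the design

-- Class `zero` carries the copies of `K (3 * x) ─ F`, the other `k` classes carry copies of
-- `K[ x ∶ 3 ]`, and the groups carry copies of `K[ x ∶ h ]`. Keeping `F` arbitrary treats both
-- parities at once: it is a 1-factor or empty.
inflated-factorization : ∀ {m n N u h b k x rβ sβ rγ sγ} (r s : ℕ → ℕ)
  (R : Resolution N u h b (suc k)) (F : Graph (Fin (3 * x))) →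
  CycleFactorization m n (K (3 * x) ─ F) rβ sβ →
  CycleFactorization m n K[ x ∶ h ] rγ sγ →
  (∀ (i : Fin k) → CycleFactorization m n K[ x ∶ 3 ] (r (toℕ i)) (s (toℕ i))) →
  CycleFactorization m n
    (K (N * x) ─ copies (relabel (↔-sym *↔×) (inflate x (Resolution.class R zero))) F)
    (sum (applyUpTo r k) + rβ + rγ) (sum (applyUpTo s k) + sβ + sγ)
inflated-factorization {N = N} {h = h} {k = k} {x} r s R F Fβ Fγ Fα =
  factorization-resp {G = (⋃ k α ∪ β) ∪ γ} {K (N * x) ─ copies Tβ F} to from
    (factorization-∪ αβ∩γ
      (factorization-∪ α∩β
        (factorization-⋃ r s α α∩α (λ i → copies-factorization (Tα i) (Fα i)))
        (copies-factorization Tβ Fβ))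
      (copies-factorization Tγ Fγ))
  where
  open Resolution R
  open IsDecomposition decomposition

  Tα : Fin k → Tiling (Fin (N * x)) _ (Fin 3 × Fin x)
  Tα i = inflate x (class (suc i))

  Tβ : Tiling (Fin (N * x)) _ (Fin (3 * x))
  Tβ = relabel (↔-sym *↔×) (inflate x (class zero))

  Tγ : Tiling (Fin (N * x)) _ (Fin h × Fin x)
  Tγ = inflate x groups

  α : Fin k → Graph (Fin (N * x))
  α i = copies (Tα i) K[ x ∶ 3 ]

  β γ : Graph (Fin (N * x))
  β = copies Tβ (K (3 * x) ─ F)
  γ = copies Tγ K[ x ∶ h ]

  point : Fin (N * x) → Fin N
  point = quotient x

  in-class : ∀ c {v y} → tile (class c) (point v) ≡ tile (class c) (point y) →
    point v ≢ point y → Adj (copies (class c) (K 3)) (point v) (point y)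
  in-class c p v≢y = p , v≢y ∘ unique (class c) p

  class-unique : ∀ {c d v y} → Adj (copies (class c) (K 3)) v y →
    Adj (copies (class d) (K 3)) v y → c ≡ d
  class-unique {c} {d} a b with partition (subgraph c a)
  ... | _ , _ , c-unique = trans (sym (c-unique a)) (c-unique b)

  α-point : ∀ i {v y} → Adj (α i) v y → point v ≢ point y
  α-point i (_ , c≢) eq = c≢ (cong (coord (class (suc i))) eq)

  γ-point : ∀ {v y} → Adj γ v y → point v ≢ point y
  γ-point (_ , c≢) eq = c≢ (cong (coord groups) eq)

  -- By computation, an edge of `α i` is an edge of a triangle of class `suc i` between the
  -- underlying points, so uniqueness of the class applies directly.
  α∩α : ∀ {i j} → i ≢ j → Disjoint (α i) (α j)
  α∩α {i} {j} i≢j a b = i≢j (suc-injective (class-unique a b))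

  α∩zero : ∀ i {v y} → Adj (α i) v y →
    tile (class zero) (point v) ≢ tile (class zero) (point y)
  α∩zero i {v} {y} a p =
    contradiction (class-unique (in-class zero {v} {y} p (α-point i {v} {y} a)) a) λ ()

  γ∩zero : ∀ {v y} → Adj γ v y →
    tile (class zero) (point v) ≢ tile (class zero) (point y)
  γ∩zero {v} {y} g p = subgraph zero (in-class zero {v} {y} p (γ-point {v} {y} g)) (proj₁ g)

  α∩β : Disjoint (⋃ k α) β
  α∩β {v} {y} a (p , _) = let (i , a′) = ⋃⁻ α a in α∩zero i {v} {y} a′ p

  αβ∩γ : Disjoint (⋃ k α ∪ β) γ
  αβ∩γ (inj₁ a) (q , _) = let (i , a′) = ⋃⁻ α a in subgraph (suc i) a′ q
  αβ∩γ {v} {y} (inj₂ (p , _)) g = γ∩zero {v} {y} g p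

  to : ((⋃ k α ∪ β) ∪ γ) ⊆ (K (N * x) ─ copies Tβ F)
  to {v} {y} (inj₁ (inj₁ a)) = let (i , a′) = ⋃⁻ α a in
    (λ v≡y → irrefl (α i) v≡y a′) , λ (p , _) → α∩zero i {v} {y} a′ p
  to (inj₁ (inj₂ (_ , c≢ , ¬f))) = (c≢ ∘ cong (coord Tβ)) , λ (_ , f) → ¬f f
  to {v} {y} (inj₂ g) = (λ v≡y → irrefl γ v≡y g) , λ (p , _) → γ∩zero {v} {y} g p

  from-zero : ∀ {v y} → tile Tβ v ≡ tile Tβ y → v ≢ y → ¬ Adj (copies Tβ F) v y → Adj β v y
  from-zero p v≢y ¬f = p , v≢y ∘ unique Tβ p , λ f → ¬f (p , f)

  from : (K (N * x) ─ copies Tβ F) ⊆ ((⋃ k α ∪ β) ∪ γ)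
  from {v} {y} (v≢y , ¬f) with point v ≟ᶠ point y
  ... | yes same = inj₁ (inj₂ (from-zero (cong (tile (class zero)) same) v≢y ¬f))
  ... | no differ with tile groups (point v) ≟ᶠ tile groups (point y)
  ...   | yes same-group = inj₂ (same-group , differ ∘ unique groups same-group)
  ...   | no differ-group with partition differ-group
  ...     | zero  , (p , _) , _ = inj₁ (inj₂ (from-zero p v≢y ¬f))
  ...     | suc i , a       , _ = inj₁ (inj₁ (⋃⁺ α i a))

-- Class count, parity and assembly

oneFactor-of-K : ∀ {v} {G F : Graph (Fin v)} → IsOneFactor G F → IsOneFactor (K v) F
oneFactor-of-K {F = F} one = record
  { subgraph  = λ a x≡y → irrefl F x≡y a
  ; neighbour = IsOneFactor.neighbour one
  }

-- Identifies the number of classes found by counting with the bound on `p` in the theorem.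
#classes-formula : ∀ {h u k} → k * 2 + h ≡ h * u → h * (u ∸ 1) / 2 ≡ k
#classes-formula {h} {u} {k} count = begin
  h * (u ∸ 1) / 2          ≡⟨ cong (_/ 2) (*-distribˡ-∸ h u 1) ⟩
  (h * u ∸ h * 1) / 2      ≡⟨ cong₂ (λ a b → (a ∸ b) / 2) (sym count) (*-identityʳ h) ⟩
  (k * 2 + h ∸ h) / 2      ≡⟨ cong (_/ 2) (m+n∸n≡m (k * 2) h) ⟩
  k * 2 / 2                ≡⟨ m*n/n≡m k 2 ⟩
  k                        ∎
  where open ≡-Reasoning

-- If 2 divides `h * u`, then `count` makes `h` even and `degree` in turn makes `x` even.
2∣hux⇒2∣x : ∀ {h u x k d} → k * 2 + h ≡ h * u → d * 2 + x ≡ h * x →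
  2 ∣ h * u * x → 2 ∣ x
2∣hux⇒2∣x {h} {u} {x} {k} {d} count degree 2∣hux
  with euclidsLemma (h * u) x prime[2] 2∣hux
... | inj₂ 2∣x  = 2∣x
... | inj₁ 2∣hu = ∣m+n∣m⇒∣n (subst (2 ∣_) (sym degree) (∣m⇒∣m*n x 2∣h)) (n∣m*n d)
  where
  2∣h : 2 ∣ h
  2∣h = ∣m+n∣m⇒∣n (subst (2 ∣_) (sym count) 2∣hu) (n∣m*n k)

2∣3x⇒2∣x : ∀ {x} → 2 ∣ 3 * x → 2 ∣ x
2∣3x⇒2∣x {x} 2∣3x with euclidsLemma 3 x prime[2] 2∣3x
... | inj₂ 2∣x = 2∣x
-- Since 3 is 2 + 1, a divisor 2 of 3 would divide 1.
... | inj₁ 2∣3 = contradiction (∣m+n∣m⇒∣n {n = 1} 2∣3 ∣-refl) (from-no (2 ∣? 1))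

lemma15 : (m n x h u : ℕ) → 3 ≤ m → 3 ≤ n → 1 ≤ x → 1 ≤ h → 1 ≤ u →
    m ∣ 3 * x → n ∣ 3 * x →
    (rβ sβ rγ sγ : ℕ) (r s : ℕ → ℕ) →
    3-RGDD h u →
    HWP m n (3 * x) rβ sβ →
    CycleFactorization m n K[ x ∶ h ] rγ sγ →
    (∀ p → 1 ≤ p → p ≤ h * (u ∸ 1) / 2 → CycleFactorization m n K[ x ∶ 3 ] (r p) (s p)) →
    let rα = sum (applyUpTo (λ i → r (suc i)) (h * (u ∸ 1) / 2 ∸ 1))
        sα = sum (applyUpTo (λ i → s (suc i)) (h * (u ∸ 1) / 2 ∸ 1))
    in HWP m n (h * u * x) (rα + rβ + rγ) (sα + sβ + sγ)
lemma15 m n x h u 3≤m 3≤n 1≤x 1≤h 1≤u _ _ rβ sβ rγ sγ r s D Fβ Fγ Fα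
  with resolution D
-- Without parallel classes the point count reads `h ≡ h * u`, forcing a single group.
... | b , zero , R =
  contradiction u≡1 (λ { refl → <-irrefl refl (3-RGDD.u>1 D) })
  where
  u≡1 : u ≡ 1
  u≡1 = *-cancelˡ-≡ u 1 h {{>-nonZero 1≤h}}
    (trans (sym (resolution-count R (*-mono-≤ 1≤h 1≤u))) (sym (*-identityʳ h)))
... | b , suc k , R = assemble Fβ (#classes-formula {h} count) Fα
  where
  count : suc k * 2 + h ≡ h * u
  count = resolution-count R (*-mono-≤ 1≤h 1≤u)

  -- The bound is abstracted to a variable `N`, so that its equation with `suc k` can be matched
  -- with `refl`.
  assemble : HWP m n (3 * x) rβ sβ → ∀ {N} → N ≡ suc k →
    (∀ p → 1 ≤ p → p ≤ N → CycleFactorization m n K[ x ∶ 3 ] (r p) (s p)) →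
    HWP m n (h * u * x) (sum (applyUpTo (r ∘ suc) (N ∸ 1)) + rβ + rγ)
                        (sum (applyUpTo (s ∘ suc) (N ∸ 1)) + sβ + sγ)
  assemble (odd 2∤3x Fβ) refl Fα = odd
    (λ 2∣hux → 2∤3x (∣n⇒∣m*n 3
      (2∣hux⇒2∣x {h} {u} {k = suc k} {rγ + sγ} count (multipartite-degree 3≤m 3≤n 1≤x 1≤h Fγ) 2∣hux)))
    (factorization-resp proj₁ (λ v≢y → v≢y , λ ())
      (inflated-factorization (r ∘ suc) (s ∘ suc) R ∅
        (factorization-resp (λ v≢y → v≢y , λ ()) proj₁ Fβ) Fγ
        -- Class `suc i` receives decomposition number `suc (toℕ i)`, as `p` starts from 1; `k`
        -- terms match sums that stop at `N ∸ 1`.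
        (λ i → Fα (suc (toℕ i)) (s≤s z≤n) (m≤n⇒m≤1+n (toℕ<n i)))))
  -- The 1-factors missing from the copies on the blocks of class `zero` together meet each vertex
  -- once, since those blocks partition the points.
  assemble (even 2∣3x F one Fβ) refl Fα = even
    (∣n⇒∣m*n (h * u) (2∣3x⇒2∣x 2∣3x))
    (copies Tβ F)
    (oneFactor-of-K (copies-oneFactor Tβ one))
    (inflated-factorization (r ∘ suc) (s ∘ suc) R F Fβ Fγ
      (λ i → Fα (suc (toℕ i)) (s≤s z≤n) (m≤n⇒m≤1+n (toℕ<n i))))
    where
    Tβ = relabel (↔-sym *↔×) (inflate x (Resolution.class R zero))
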